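{- For every integer $s\ge 2$, every locally $s$-colourable graph $G$ of chromatic number $\chi < \frac{11s+16}{6}$ satisfies $\varphi(G)\ge \chi-s$.
   Context: All graphs are finite, simple and non-empty. A graph $G$ is locally $s$-colourable if for every vertex $v$ the subgraph induced by the closed neighbourhood $N[v]$ has chromatic number at most $s$. For a proper colouring $\sigma$ of $G$, $\varphi_\sigma(G)=\max_{H}\big(|\sigma(V(H))|-\chi(H)\big)$ over all induced subgraphs $H$ of $G$; the chromatic discrepancy is $\varphi(G)=\min_\sigma \varphi_\sigma(G)$ over all proper colourings $\sigma$ of $G$. -}

module Defs where

open import Data.Nat using (ℕ; suc; _<_; _≤_; _∸_; _≟_)
open import Data.Fin using (Fin)
import Data.Fin as Fin
open import Relation.Nullary.Decidable using (⌊_⌋)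
open import Data.Bool using (Bool; true; false; _∨_)
open import Data.List using (List; length; map; filterᵇ; allFin; deduplicate)
open import Data.Product using (Σ; ∃; ∃-syntax; _×_)
open import Relation.Binary.PropositionalEquality using (_≡_; _≢_)

record Graph (n : ℕ) : Set where
  field
    adj   : Fin n → Fin n → Bool
    sym   : ∀ u v → adj u v ≡ adj v u
    irref : ∀ v → adj v v ≡ false
open Graph public

-- Vertex subsets (used to describe induced subgraphs G[S]).
VSet : ℕ → Set
VSet n = Fin n → Bool

_∈ₛ_ : ∀ {n} → Fin n → VSet n → Set
v ∈ₛ S = S v ≡ true

NonEmpty : ∀ {n} → VSet n → Set
NonEmpty {n} S = ∃[ v ] v ∈ₛ S

full : ∀ {n} → VSet n
full _ = true

closedNbhd : ∀ {n} → Graph n → Fin n → VSet n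
closedNbhd {n} G v u = ⌊ v Fin.≟ u ⌋ ∨ adj G v u

Colouring : ℕ → Set
Colouring n = Fin n → ℕ

ProperOn : ∀ {n} → Graph n → VSet n → Colouring n → Set
ProperOn G S c = ∀ u v → u ∈ₛ S → v ∈ₛ S → adj G u v ≡ true → c u ≢ c v

ProperColouringWith : ∀ {n} → Graph n → VSet n → ℕ → Colouring n → Set
ProperColouringWith G S k c = ProperOn G S c × (∀ v → v ∈ₛ S → c v < k)

Colourable : ∀ {n} → Graph n → VSet n → ℕ → Set
Colourable {n} G S k = ∃[ c ] ProperColouringWith G S k c

IsChromaticNumber : ∀ {n} → Graph n → VSet n → ℕ → Set
IsChromaticNumber G S k = Colourable G S k × (∀ m → Colourable G S m → k ≤ m)

numColours : ∀ {n} → Colouring n → VSet n → ℕ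
numColours {n} σ S = length (deduplicate _≟_ (map σ (filterᵇ S (allFin n))))

-- value of the induced subgraph H = G[S] for σ : |σ(V(H))| - χ(H)
-- (for a proper σ this is nonnegative, so truncated subtraction is exact)
HValue : ∀ {n} → Graph n → Colouring n → VSet n → ℕ → Set
HValue G σ S d = ∃[ k ] (IsChromaticNumber G S k × d ≡ numColours σ S ∸ k)

IsPhiSigma : ∀ {n} → Graph n → Colouring n → ℕ → Set
IsPhiSigma {n} G σ d =
  (∃[ S ] (NonEmpty S × HValue G σ S d)) ×
  (∀ (S : VSet n) e → NonEmpty S → HValue G σ S e → e ≤ d)

IsChromaticDiscrepancy : ∀ {n} → Graph n → ℕ → Set
IsChromaticDiscrepancy {n} G d =
  (∃[ σ ] (ProperOn G full σ × IsPhiSigma G σ d)) ×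
  (∀ (σ : Colouring n) e → ProperOn G full σ → IsPhiSigma G σ e → d ≤ e)

LocallyColourable : ∀ {n} → Graph n → ℕ → Set
LocallyColourable G s = ∀ v → Colourable G (closedNbhd G v) s

{-# OPTIONS --safe #-}

-- Suppose φ + s < χ, let σ attain the discrepancy, and let m be the number of colours of σ. Every closed neighbourhood
-- sees at most φ + s < χ colours, so m = χ is impossible: the last colour class could be absorbed into the others. Hence
-- m > χ, and a transversal R of the colour classes has m vertices, is locally s-colourable and has χ(R) ≥ m - φ ≥ s + 2.
-- This is refuted by: a locally (k - 2)-colourable graph of chromatic number at least k has at least 11k/6 vertices.
-- A minimal counterexample to the latter is vertex-critical and not a join, so by Gallai's theorem it has at least 2k - 1
-- vertices; only k ≤ 5 remains.
--
-- Gallai's theorem: among the k-colourings choose c₁ with as few singleton classes as possible; with fewer than 2k - 1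
-- vertices it has two singletons x ≠ y. If z is not adjacent to y, take a k-colouring c₂ with singleton z, modified so
-- that its other singletons are singletons of c₁. As y is not among them, minimality forces x to be one, so that c₂ is
-- again optimal and has the singletons x and z. The vertices that can replace y in this way are therefore closed under
-- non-adjacency and exclude x, and the graph is a join.
module Submission where

open import Defs
open import Data.Nat using (ℕ; zero; suc; _+_; _*_; _<_; _≤_; z≤n; s≤s; _≟_; _≤?_; _∸_; pred; >-nonZero)
open import Data.Nat.Properties
open import Data.Fin using (Fin; zero; suc; toℕ)
import Data.Fin as Fin
open import Data.Fin.Properties using (any?; all?; toℕ<n; toℕ-injective; ¬∀⟶∃¬; injective⇒≤)
open import Data.Bool using (Bool; true; false; if_then_else_; T)
open import Data.Bool.Properties using (T?; T-≡)
import Data.Bool as Bool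
open import Data.Product using (∃-syntax; _×_; _,_; proj₁; proj₂)
open import Data.Sum using (_⊎_; inj₁; inj₂; [_,_]′)
open import Data.Empty using (⊥; ⊥-elim)
open import Function using (_∘_)
open import Function.Bundles using (Equivalence)
open import Relation.Nullary using (¬_; Dec; yes; no; does; contradiction)
open import Relation.Nullary.Decidable using (⌊_⌋; _×-dec_; _⊎-dec_; _→-dec_; ¬?; dec-true; decidable-stable; toSum; ¬¬-excluded-middle)
open import Relation.Unary using (Pred; Decidable)
open import Relation.Binary.PropositionalEquality using (_≡_; _≢_; refl; trans; cong; subst; module ≡-Reasoning) renaming (sym to ≡-sym)
open import Level using (0ℓ)
open import Data.Nat.Tactic.RingSolver using (solve-∀)
open import Data.List using (List; length; map; filterᵇ; allFin; deduplicate; lookup)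
open import Data.List.Membership.Propositional using (_∈_)
open import Data.List.Membership.Propositional.Properties
  using (∈-deduplicate⁺; ∈-deduplicate⁻; ∈-map⁺; ∈-map⁻; ∈-filter⁺; ∈-filter⁻; ∈-allFin; ∈-lookup)
open import Data.List.Relation.Unary.All as All using (_∷_)
open import Data.List.Relation.Unary.AllPairs using (_∷_)
open import Data.List.Relation.Unary.Any using (index)
open import Data.List.Relation.Unary.Any.Properties using (lookup-index)
open import Data.List.Relation.Unary.Unique.Propositional using (Unique)
open import Data.List.Relation.Unary.Unique.DecPropositional.Properties using (deduplicate-!)

private
  variable
    n : ℕ

-- Vertex sets

_∈?_ : (v : Fin n) (S : VSet n) → Dec (v ∈ₛ S)
v ∈? S = S v Bool.≟ true

⟦_⟧ : {P : Pred (Fin n) 0ℓ} → Decidable P → VSet n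
⟦ P? ⟧ v = does (P? v)

∈⟦⟧⁺ : {P : Pred (Fin n) 0ℓ} (P? : Decidable P) {v : Fin n} → P v → v ∈ₛ ⟦ P? ⟧
∈⟦⟧⁺ P? {v} p = dec-true (P? v) p

∈⟦⟧⁻ : {P : Pred (Fin n) 0ℓ} (P? : Decidable P) {v : Fin n} → v ∈ₛ ⟦ P? ⟧ → P v
∈⟦⟧⁻ P? {v} q with P? v
... | yes p = p
... | no _ = contradiction q λ ()

_⊆_ : VSet n → VSet n → Set
S ⊆ T = ∀ v → v ∈ₛ S → v ∈ₛ T

Disjoint : VSet n → VSet n → Set
Disjoint A B = ∀ v → v ∈ₛ A → ¬ v ∈ₛ B

_⊆_∪_ : VSet n → VSet n → VSet n → Set
S ⊆ A ∪ B = ∀ v → v ∈ₛ S → v ∈ₛ A ⊎ v ∈ₛ B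

⁅_⁆ : Fin n → VSet n
⁅ v ⁆ = ⟦ Fin._≟ v ⟧

_∩_ : VSet n → VSet n → VSet n
S ∩ T = ⟦ (λ v → v ∈? S ×-dec v ∈? T) ⟧

_∖_ : VSet n → VSet n → VSet n
S ∖ T = ⟦ (λ v → v ∈? S ×-dec ¬? (v ∈? T)) ⟧

fibre : VSet n → Colouring n → ℕ → VSet n
fibre S c i = ⟦ (λ v → v ∈? S ×-dec c v ≟ i) ⟧

∈⁅⁆⁺ : {u v : Fin n} → u ≡ v → u ∈ₛ ⁅ v ⁆
∈⁅⁆⁺ {v = v} = ∈⟦⟧⁺ (Fin._≟ v)

∈⁅⁆⁻ : {u v : Fin n} → u ∈ₛ ⁅ v ⁆ → u ≡ v
∈⁅⁆⁻ {v = v} = ∈⟦⟧⁻ (Fin._≟ v)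

module _ (S T : VSet n) {v : Fin n} where

  ∈∩⁺ : v ∈ₛ S → v ∈ₛ T → v ∈ₛ (S ∩ T)
  ∈∩⁺ p q = ∈⟦⟧⁺ (λ v → v ∈? S ×-dec v ∈? T) (p , q)

  ∈∩⁻ : v ∈ₛ (S ∩ T) → v ∈ₛ S × v ∈ₛ T
  ∈∩⁻ = ∈⟦⟧⁻ (λ v → v ∈? S ×-dec v ∈? T)

  ∈∖⁺ : v ∈ₛ S → ¬ v ∈ₛ T → v ∈ₛ (S ∖ T)
  ∈∖⁺ p q = ∈⟦⟧⁺ (λ v → v ∈? S ×-dec ¬? (v ∈? T)) (p , q)

  ∈∖⁻ : v ∈ₛ (S ∖ T) → v ∈ₛ S × ¬ v ∈ₛ T
  ∈∖⁻ = ∈⟦⟧⁻ (λ v → v ∈? S ×-dec ¬? (v ∈? T))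

module _ (S : VSet n) (c : Colouring n) {i : ℕ} {v : Fin n} where

  ∈fibre⁺ : v ∈ₛ S → c v ≡ i → v ∈ₛ fibre S c i
  ∈fibre⁺ p q = ∈⟦⟧⁺ (λ v → v ∈? S ×-dec c v ≟ i) (p , q)

  ∈fibre⁻ : v ∈ₛ fibre S c i → v ∈ₛ S × c v ≡ i
  ∈fibre⁻ = ∈⟦⟧⁻ (λ v → v ∈? S ×-dec c v ≟ i)

∖-⊆ : (S T : VSet n) → (S ∖ T) ⊆ S
∖-⊆ S T v p = proj₁ (∈∖⁻ S T p)

⊆-∖-∪ : (S T : VSet n) → S ⊆ T ∪ (S ∖ T)
⊆-∖-∪ S T v p = [ inj₁ , (λ q → inj₂ (∈∖⁺ S T p q)) ]′ (toSum (v ∈? T))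

-- Cardinalities

count : VSet n → ℕ
count {zero} S = 0
count {suc n} S = (if S zero then 1 else 0) + count (S ∘ suc)

count-empty : {S : VSet n} → (∀ v → ¬ v ∈ₛ S) → count S ≡ 0
count-empty {zero} e = refl
count-empty {suc n} {S} e with S zero in p
... | true = contradiction p (e zero)
... | false = count-empty (e ∘ suc)

count-⁅⁆ : (v : Fin n) → count ⁅ v ⁆ ≡ 1
count-⁅⁆ {suc n} zero = cong suc (count-empty {n = n} {S = λ _ → false} λ v ())
count-⁅⁆ (suc v) = count-⁅⁆ v

count-cover : {S A B : VSet n} → S ⊆ A ∪ B → count S ≤ count A + count B
count-cover {zero} h = z≤n
count-cover {suc n} {S} {A} {B} h with S zero in s | A zero in a | B zero in b | count-cover {S = S ∘ suc} {A ∘ suc} {B ∘ suc} (λ v → h (suc v))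
... | false | false | false | ih = ih
... | false | false | true  | ih = ≤-trans ih (+-monoʳ-≤ (count (A ∘ suc)) (n≤1+n _))
... | false | true  | false | ih = m≤n⇒m≤1+n ih
... | false | true  | true  | ih = m≤n⇒m≤1+n (≤-trans ih (+-monoʳ-≤ (count (A ∘ suc)) (n≤1+n _)))
... | true  | true  | false | ih = s≤s ih
... | true  | true  | true  | ih = s≤s (≤-trans ih (+-monoʳ-≤ (count (A ∘ suc)) (n≤1+n _)))
... | true  | false | true  | ih = ≤-trans (s≤s ih) (≤-reflexive (≡-sym (+-suc _ _)))
... | true  | false | false | ih with h zero s
...   | inj₁ p = contradiction (trans (≡-sym a) p) λ ()
...   | inj₂ p = contradiction (trans (≡-sym b) p) λ ()

count-disjoint : {S A B : VSet n} → A ⊆ S → B ⊆ S → Disjoint A B → count A + count B ≤ count S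
count-disjoint {zero} f g d = z≤n
count-disjoint {suc n} {S} {A} {B} f g d with S zero in s | A zero in a | B zero in b | count-disjoint {S = S ∘ suc} {A ∘ suc} {B ∘ suc} (λ v → f (suc v)) (λ v → g (suc v)) (λ v → d (suc v))
... | _     | true  | true  | ih = contradiction b (d zero a)
... | false | true  | false | ih = contradiction (trans (≡-sym s) (f zero a)) λ ()
... | false | false | true  | ih = contradiction (trans (≡-sym s) (g zero b)) λ ()
... | false | false | false | ih = ih
... | true  | false | false | ih = m≤n⇒m≤1+n ih
... | true  | true  | false | ih = s≤s ih
... | true  | false | true  | ih = ≤-trans (≤-reflexive (+-suc _ _)) (s≤s ih)

count-mono : {S T : VSet n} → S ⊆ T → count S ≤ count T
count-mono {S = S} {T} h = m+n≤o⇒m≤o (count S)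
  (count-disjoint {B = λ _ → false} h (λ v ()) (λ v _ ()))

count-∖ : (S : VSet n) (v : Fin n) → count S ≤ suc (count (S ∖ ⁅ v ⁆))
count-∖ S v = ≤-trans (count-cover (⊆-∖-∪ S ⁅ v ⁆)) (+-monoˡ-≤ _ (≤-reflexive (count-⁅⁆ v)))

count-∖-∈ : (S : VSet n) {v : Fin n} → v ∈ₛ S → suc (count (S ∖ ⁅ v ⁆)) ≤ count S
count-∖-∈ S {v} p = ≤-trans (+-monoˡ-≤ _ (≤-reflexive (≡-sym (count-⁅⁆ v))))
  (count-disjoint (λ u q → subst (_∈ₛ S) (≡-sym (∈⁅⁆⁻ q)) p) (∖-⊆ S ⁅ v ⁆)
    (λ u q r → proj₂ (∈∖⁻ S ⁅ v ⁆ r) q))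

∈∖⁅⁆⁺ : (S : VSet n) {u v : Fin n} → u ∈ₛ S → u ≢ v → u ∈ₛ (S ∖ ⁅ v ⁆)
∈∖⁅⁆⁺ S {v = v} p q = ∈∖⁺ S ⁅ v ⁆ p (q ∘ ∈⁅⁆⁻)

count-⊂ : {S T : VSet n} {v : Fin n} → S ⊆ T → v ∈ₛ T → ¬ v ∈ₛ S → count S < count T
count-⊂ {S = S} {T} {v} h p q = ≤-trans (s≤s (count-mono h′)) (count-∖-∈ T p)
  where
  h′ : S ⊆ (T ∖ ⁅ v ⁆)
  h′ u r = ∈∖⁅⁆⁺ T (h u r) λ where refl → q r

count>0 : (S : VSet n) {v : Fin n} → v ∈ₛ S → 0 < count S
count>0 S p = ≤-trans (s≤s z≤n) (count-∖-∈ S p)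

count≥2 : (S : VSet n) {u v : Fin n} → u ∈ₛ S → v ∈ₛ S → u ≢ v → 2 ≤ count S
count≥2 S {v = v} p q r = ≤-trans (s≤s (count>0 (S ∖ ⁅ v ⁆) (∈∖⁅⁆⁺ S p r))) (count-∖-∈ S q)

∈-or-empty : (S : VSet n) → NonEmpty S ⊎ (∀ v → ¬ v ∈ₛ S)
∈-or-empty S with any? (_∈? S)
... | yes p = inj₁ p
... | no p = inj₂ λ v q → p (v , q)

count-subsingleton : {S : VSet n} → (∀ u v → u ∈ₛ S → v ∈ₛ S → u ≡ v) → count S ≤ 1
count-subsingleton {S = S} h with ∈-or-empty S
... | inj₂ e = ≤-trans (≤-reflexive (count-empty e)) z≤n
... | inj₁ (v , p) = ≤-trans (count-mono (λ u q → ∈⁅⁆⁺ (h u v q p))) (≤-reflexive (count-⁅⁆ v))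

-- Induction on the number of colours, removing the last class. With `b = 1` this bounds
-- transversals and cliques, with `b = 2` a set without independent triples.
count-fibres-≤ : (S : VSet n) (c : Colouring n) → ∀ k b → (∀ v → v ∈ₛ S → c v < k) →
  (∀ i → i < k → count (fibre S c i) ≤ b) → count S ≤ k * b
count-fibres-≤ S c zero b h g = ≤-reflexive (count-empty λ v p → contradiction (h v p) λ ())
count-fibres-≤ S c (suc k) b h g =
  ≤-trans (count-cover (⊆-∖-∪ S F)) (+-mono-≤ (g k ≤-refl) (count-fibres-≤ (S ∖ F) c k b h′ g′))
  where
  F = fibre S c k
  h′ : ∀ v → v ∈ₛ (S ∖ F) → c v < k
  h′ v p with ∈∖⁻ S F p
  ... | q , r = ≤∧≢⇒< (≤-pred (h v q)) (λ e → r (∈fibre⁺ S c q e))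
  g′ : ∀ i → i < k → count (fibre (S ∖ F) c i) ≤ b
  g′ i i<k = ≤-trans (count-mono sub) (g i (m≤n⇒m≤1+n i<k))
    where
    sub : fibre (S ∖ F) c i ⊆ fibre S c i
    sub v p with ∈fibre⁻ (S ∖ F) c p
    ... | q , r = ∈fibre⁺ S c (∖-⊆ S F v q) r

count-fibres-≥ : (S : VSet n) (c : Colouring n) → ∀ k b → (∀ i → i < k → b ≤ count (fibre S c i)) → k * b ≤ count S
count-fibres-≥ S c zero b g = z≤n
count-fibres-≥ S c (suc k) b g =
  ≤-trans (+-mono-≤ (g k ≤-refl) (count-fibres-≥ (S ∖ F) c k b g′))
    (count-disjoint (λ v p → proj₁ (∈fibre⁻ S c p)) (∖-⊆ S F) (λ v p q → proj₂ (∈∖⁻ S F q) p))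
  where
  F = fibre S c k
  g′ : ∀ i → i < k → b ≤ count (fibre (S ∖ F) c i)
  g′ i i<k = ≤-trans (g i (m≤n⇒m≤1+n i<k)) (count-mono sub)
    where
    sub : fibre S c i ⊆ fibre (S ∖ F) c i
    sub v p with ∈fibre⁻ S c p
    ... | q , refl = ∈fibre⁺ (S ∖ F) c (∈∖⁺ S F q (λ r → <⇒≢ i<k (proj₂ (∈fibre⁻ S c r)))) refl

-- Classical reasoning under a double negation

-- Descent: if no element were minimal, every value could be undercut, and the fuel `m` bounds how
-- often.
¬¬-minimal : {A : Set} (f : A → ℕ) → A → ¬ ¬ (∃[ a ] (∀ b → f a ≤ f b))
¬¬-minimal {A} f a k = go (suc (f a)) a ≤-refl
  where
  go : ∀ m a → f a < m → ⊥
  go (suc m) a h = k (a , λ b → ≮⇒≥ (λ b<a → go m b (≤-trans b<a (≤-pred h))))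

-- Excluded middle under a double negation, gathered over finitely many vertices. It turns a
-- predicate that quantifies over colourings, such as `Partner`, into a vertex set.
¬¬-decide : (P : Pred (Fin n) 0ℓ) → ¬ ¬ Decidable P
¬¬-decide {zero} P k = k λ ()
¬¬-decide {suc n} P k = ¬¬-excluded-middle λ p → ¬¬-decide (P ∘ suc) λ q →
  k λ where
    zero → p
    (suc v) → q v

-- Proper colourings and colour classes

module Colourings {N : ℕ} (G : Graph N) where

  Independent : VSet N → Set
  Independent I = ∀ u v → u ∈ₛ I → v ∈ₛ I → adj G u v ≢ true

  Complete : VSet N → VSet N → Set
  Complete A B = ∀ u v → u ∈ₛ A → v ∈ₛ B → adj G u v ≡ true

  adj-sym : ∀ {u v} → adj G u v ≡ true → adj G v u ≡ true
  adj-sym {u} {v} = trans (sym G v u)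

  adj⇒≢ : ∀ {u v} → adj G u v ≡ true → u ≢ v
  adj⇒≢ {u} a refl = contradiction (trans (≡-sym a) (irref G u)) λ ()

  ∈closedNbhd-self : ∀ v → v ∈ₛ closedNbhd G v
  ∈closedNbhd-self v with v Fin.≟ v
  ... | yes _ = refl
  ... | no q = contradiction refl q

  ∈closedNbhd-adj : ∀ {u v} → adj G v u ≡ true → u ∈ₛ closedNbhd G v
  ∈closedNbhd-adj {u} {v} a with v Fin.≟ u
  ... | yes _ = refl
  ... | no _ = a

  ∈closedNbhd⁻ : ∀ {u v} → u ∈ₛ closedNbhd G v → v ≢ u → adj G v u ≡ true
  ∈closedNbhd⁻ {u} {v} p q with v Fin.≟ u
  ... | yes e = contradiction e q
  ... | no _ = p

  proper-mono : ∀ {S T c} → S ⊆ T → ProperOn G T c → ProperOn G S c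
  proper-mono h P u v p q = P u v (h u p) (h v q)

  colourable-mono : ∀ {S T k l} → S ⊆ T → k ≤ l → Colourable G T k → Colourable G S l
  colourable-mono h k≤l (c , P , b) = c , proper-mono h P , λ v p → ≤-trans (b v (h v p)) k≤l

  colourable-∪ : ∀ {S A B a b} → S ⊆ A ∪ B → Colourable G A a → Colourable G B b → Colourable G S (a + b)
  colourable-∪ {S} {A} {B} {a} {b} h (cA , PA , bA) (cB , PB , bB) = c , P , bound
    where
    c : Colouring N
    c v = if A v then cA v else a + cB v
    inB : ∀ {v} → v ∈ₛ S → A v ≡ false → v ∈ₛ B
    inB {v} p q with h v p
    ... | inj₁ r = contradiction (trans (≡-sym q) r) λ ()
    ... | inj₂ r = r
    P : ProperOn G S c
    P u v p q uv with A u in eu | A v in ev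
    ... | true  | true  = PA u v eu ev uv
    ... | true  | false = <⇒≢ (≤-trans (bA u eu) (m≤m+n a _))
    ... | false | true  = λ e → <⇒≢ (≤-trans (bA v ev) (m≤m+n a _)) (≡-sym e)
    ... | false | false = PB u v (inB p eu) (inB q ev) uv ∘ +-cancelˡ-≡ a _ _
    bound : ∀ v → v ∈ₛ S → c v < a + b
    bound v p with A v in ev
    ... | true  = ≤-trans (bA v ev) (m≤m+n a b)
    ... | false = +-monoʳ-< a (bB v (inB p ev))

  colourable-all : ∀ S → Colourable G S N
  colourable-all S = toℕ , (λ u v _ _ a e → adj⇒≢ a (toℕ-injective e)) , λ v _ → toℕ<n v

  independent⇒colourable : ∀ {I} → Independent I → Colourable G I 1
  independent⇒colourable h = (λ _ → 0) , (λ u v p q a _ → h u v p q a) , λ _ _ → s≤s z≤n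

  fibre-independent : ∀ {S c} i → ProperOn G S c → Independent (fibre S c i)
  fibre-independent {S} {c} i P u v p q a with ∈fibre⁻ S c p | ∈fibre⁻ S c q
  ... | pu , cu | pv , cv = P u v pu pv a (trans cu (≡-sym cv))

  ¬¬-chromatic : ∀ S → ¬ ¬ (∃[ k ] IsChromaticNumber G S k)
  ¬¬-chromatic S k = ¬¬-minimal proj₁ (N , colourable-all S)
    λ ((a , ca) , min) → k (a , ca , λ m cm → min (m , cm))

  -- The class of colour `κ` is independent, so its vertices can be recoloured separately: `f v` has
  -- to avoid only the old colours of the neighbours of `v`.
  absorb-class : ∀ {S κ c} → ProperColouringWith G S (suc κ) c → (f : Colouring N) →
    (∀ v → v ∈ₛ S → c v ≡ κ → f v < κ × (∀ u → u ∈ₛ S → adj G v u ≡ true → c u ≢ f v)) →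
    Colourable G S κ
  absorb-class {S} {κ} {c} (P , b) f h = c′ , P′ , b′
    where
    c′ : Colouring N
    c′ v = if ⌊ c v ≟ κ ⌋ then f v else c v
    P′ : ProperOn G S c′
    P′ u v p q a with c u ≟ κ | c v ≟ κ
    ... | yes cu | yes cv = λ _ → P u v p q a (trans cu (≡-sym cv))
    ... | yes cu | no _   = λ e → proj₂ (h u p cu) v q a (≡-sym e)
    ... | no _   | yes cv = proj₂ (h v q cv) u p (adj-sym a)
    ... | no _   | no _   = P u v p q a
    b′ : ∀ v → v ∈ₛ S → c′ v < κ
    b′ v p with c v ≟ κ
    ... | yes cv = proj₁ (h v p cv)
    ... | no cv  = ≤∧≢⇒< (≤-pred (b v p)) cv

  -- The last colour is renamed to the absent colour `i`; if `i` is itself the last colour, its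
  -- class is empty.
  drop-colour : ∀ {S κ c i} → ProperColouringWith G S (suc κ) c → i < suc κ →
    (∀ v → v ∈ₛ S → c v ≢ i) → Colourable G S κ
  drop-colour {i = i} C i<k h = absorb-class C (λ _ → i) λ v p cv →
    ≤∧≢⇒< (≤-pred i<k) (λ { refl → h v p cv }) , λ u q _ → h u q

  -- The last colour is credited to `X` if it occurs there and to `B` otherwise. In a join, this
  -- divides the colours of a neighbourhood between the two sides.
  split-colours : ∀ l {X B c} → (∀ v → v ∈ₛ X → c v < l) → (∀ v → v ∈ₛ B → c v < l) →
    ProperOn G X c → ProperOn G B c → (∀ u v → u ∈ₛ X → v ∈ₛ B → c u ≢ c v) →
    ∃[ l₁ ] ∃[ l₂ ] (l₁ + l₂ ≡ l × Colourable G X l₁ × Colourable G B l₂)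
  split-colours zero {c = c} hX hB PX PB d = 0 , 0 , refl , (c , PX , hX) , (c , PB , hB)
  split-colours (suc l) {X} {B} {c} hX hB PX PB d with ∈-or-empty (fibre X c l)
  ... | inj₁ (x , px) with ∈fibre⁻ X c px
  ...   | xX , cx
          with split-colours l (below X hX) (λ v q → ≤∧≢⇒< (≤-pred (hB v q)) λ e → d x v xX q (trans cx (≡-sym e)))
                 (proper-mono (∖-⊆ X (fibre X c l)) PX) PB (λ u v p → d u v (∖-⊆ X (fibre X c l) u p))
    where
    below : ∀ Y → (∀ v → v ∈ₛ Y → c v < suc l) → ∀ v → v ∈ₛ (Y ∖ fibre Y c l) → c v < l
    below Y h v p with ∈∖⁻ Y (fibre Y c l) p
    ... | q , r = ≤∧≢⇒< (≤-pred (h v q)) (r ∘ ∈fibre⁺ Y c q)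
  ...     | l₁ , l₂ , e , C₁ , C₂ = suc l₁ , l₂ , cong suc e ,
            colourable-∪ (⊆-∖-∪ X (fibre X c l)) (independent⇒colourable (fibre-independent l PX)) C₁ , C₂
  split-colours (suc l) {X} {B} {c} hX hB PX PB d | inj₂ empty
    with split-colours l {X} {B ∖ fibre B c l} (λ v q → ≤∧≢⇒< (≤-pred (hX v q)) (empty v ∘ ∈fibre⁺ X c q)) below
           PX (proper-mono (∖-⊆ B (fibre B c l)) PB) (λ u v p q → d u v p (∖-⊆ B (fibre B c l) v q))
    where
    below : ∀ v → v ∈ₛ (B ∖ fibre B c l) → c v < l
    below v p with ∈∖⁻ B (fibre B c l) p
    ... | q , r = ≤∧≢⇒< (≤-pred (hB v q)) (r ∘ ∈fibre⁺ B c q)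
  ... | l₁ , l₂ , e , C₁ , C₂ = l₁ , suc l₂ , trans (+-suc l₁ l₂) (cong suc e) , C₁ ,
        colourable-∪ (⊆-∖-∪ B (fibre B c l)) (independent⇒colourable (fibre-independent l PB)) C₂

  -- Singleton classes and Gallai's theorem

  Single : VSet N → Colouring N → Pred (Fin N) 0ℓ
  Single S c v = v ∈ₛ S × (∀ u → u ∈ₛ S → c u ≡ c v → u ≡ v)

  single? : ∀ S c → Decidable (Single S c)
  single? S c v = v ∈? S ×-dec all? λ u → u ∈? S →-dec (c u ≟ c v →-dec u Fin.≟ v)

  singles : VSet N → Colouring N → VSet N
  singles S c = ⟦ single? S c ⟧

  module _ {S : VSet N} {κ : ℕ} (χ>κ : ¬ Colourable G S κ) where

    -- Otherwise `u` could take the colour of `v`, whose only holder is not adjacent to it, and the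
    -- freed colour `c u` could be dropped.
    singles-adjacent : ∀ {c u v} → ProperColouringWith G S (suc κ) c →
      Single S c u → Single S c v → u ≢ v → adj G u v ≡ true
    singles-adjacent {c} {u} {v} (P , b) (pu , hu) (pv , hv) u≢v with adj G u v in uv
    ... | true = refl
    ... | false = ⊥-elim (χ>κ (drop-colour (P′ , b′) (b u pu) unused))
      where
      c′ : Colouring N
      c′ w = if ⌊ w Fin.≟ u ⌋ then c v else c w
      meets : ∀ w → w ∈ₛ S → adj G u w ≡ true → c v ≢ c w
      meets w q a e with hv w q (≡-sym e)
      ... | refl = contradiction (trans (≡-sym uv) a) λ ()
      P′ : ProperOn G S c′
      P′ x y p q a with x Fin.≟ u | y Fin.≟ u
      ... | yes refl | yes refl = λ _ → adj⇒≢ a refl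
      ... | yes refl | no _ = meets y q a
      ... | no _ | yes refl = meets x p (adj-sym a) ∘ ≡-sym
      ... | no _ | no _ = P x y p q a
      b′ : ∀ w → w ∈ₛ S → c′ w < suc κ
      b′ w q with w Fin.≟ u
      ... | yes _ = b v pv
      ... | no _ = b w q
      unused : ∀ w → w ∈ₛ S → c′ w ≢ c u
      unused w q with w Fin.≟ u
      ... | yes _ = λ e → u≢v (≡-sym (hu v pv e))
      ... | no w≢u = w≢u ∘ hu w q

    class-nonempty : ∀ {c i} → ProperColouringWith G S (suc κ) c → i < suc κ → NonEmpty (fibre S c i)
    class-nonempty {c} {i} C i<k with ∈-or-empty (fibre S c i)
    ... | inj₁ p = p
    ... | inj₂ e = ⊥-elim (χ>κ (drop-colour C i<k λ v p q → e v (∈fibre⁺ S c p q)))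

    nonsingle-class : ∀ {c i} → ProperColouringWith G S (suc κ) c → i < suc κ →
      (∀ v → c v ≡ i → ¬ Single S c v) → 2 ≤ count (fibre S c i)
    nonsingle-class {c} {i} C i<k h with class-nonempty C i<k
    ... | v , p with ∈fibre⁻ S c p
    ...   | pv , refl = ≮⇒≥ λ small → h v refl (pv , λ u pu e → decidable-stable (u Fin.≟ v) λ u≢v →
              <⇒≱ small (count≥2 (fibre S c i) (∈fibre⁺ S c pu e) p u≢v))

    -- c′ renames colour κ to the colour of x on S ∖ {x}, so that exactly the κ classes not containing x remain.
    count-unique-single : ∀ {c x} → ProperColouringWith G S (suc κ) c → x ∈ₛ S →
      (∀ y → Single S c y → y ≡ x) → 2 * κ < count S
    count-unique-single {c} {x} C px h = ≤-trans (s≤s (≤-trans (≤-reflexive (*-comm 2 κ))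
      (count-fibres-≥ (S ∖ ⁅ x ⁆) c′ κ 2 big))) (count-∖-∈ S px)
      where
      c′ : Colouring N
      c′ v = if ⌊ c v ≟ κ ⌋ then c x else c v
      other : ∀ {i} → i < suc κ → i ≢ c x → 2 ≤ count (fibre S c i)
      other i<k i≢ = nonsingle-class C i<k λ v e s → i≢ (trans (≡-sym e) (cong c (h v s)))
      old : ∀ {i} → i < suc κ → i ≢ c x → ∀ j → (∀ v → c v ≡ i → c′ v ≡ j) → 2 ≤ count (fibre (S ∖ ⁅ x ⁆) c′ j)
      old {i} i<k i≢ j f = ≤-trans (other i<k i≢) (count-mono sub)
        where
        sub : fibre S c i ⊆ fibre (S ∖ ⁅ x ⁆) c′ j
        sub v p with ∈fibre⁻ S c p
        ... | q , e = ∈fibre⁺ (S ∖ ⁅ x ⁆) c′ (∈∖⁅⁆⁺ S q λ { refl → i≢ (≡-sym e) }) (f v e)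
      big : ∀ i → i < κ → 2 ≤ count (fibre (S ∖ ⁅ x ⁆) c′ i)
      big i i<κ with i ≟ c x
      ... | no i≢ = old (m≤n⇒m≤1+n i<κ) i≢ i f
        where
        f : ∀ v → c v ≡ i → c′ v ≡ i
        f v e with c v ≟ κ
        ... | yes q = contradiction (trans (≡-sym e) q) (<⇒≢ i<κ)
        ... | no _ = e
      ... | yes refl = old ≤-refl (<⇒≢ i<κ ∘ ≡-sym) (c x) f
        where
        f : ∀ v → c v ≡ κ → c′ v ≡ c x
        f v e with c v ≟ κ
        ... | yes _ = refl
        ... | no q = contradiction e q

    -- The vertices whose `c₁`-class is broken up by `c₂`; their number is the measure that
    -- decreases in `align-singles`.
    Split : Colouring N → Colouring N → Pred (Fin N) 0ℓ
    Split c₁ c₂ v = v ∈ₛ S × ∃[ u ] (u ∈ₛ S × c₁ u ≡ c₁ v × c₂ u ≢ c₂ v)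

    split? : ∀ c₁ c₂ → Decidable (Split c₁ c₂)
    split? c₁ c₂ v = v ∈? S ×-dec any? λ u → u ∈? S ×-dec c₁ u ≟ c₁ v ×-dec ¬? (c₂ u ≟ c₂ v)

    -- If {a} is a class of c₂ but not of c₁, it is enlarged in c₂ to the c₁-class of a; this unsplits a and splits nothing.
    align-singles : ∀ {c₁ z} → ProperColouringWith G S (suc κ) c₁ → ∀ m c₂ → count ⟦ split? c₁ c₂ ⟧ < m →
      ProperColouringWith G S (suc κ) c₂ → Single S c₂ z →
      ∃[ c₃ ] (ProperColouringWith G S (suc κ) c₃ × Single S c₃ z × (∀ a → Single S c₃ a → a ≢ z → Single S c₁ a))
    align-singles {c₁} {z} C₁@(P₁ , b₁) (suc m) c₂ fuel C₂@(P₂ , b₂) sz@(pz , hz)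
      with any? (λ a → single? S c₂ a ×-dec ¬? (a Fin.≟ z) ×-dec ¬? (single? S c₁ a))
    ... | no none = c₂ , C₂ , sz , λ a sa a≢z → decidable-stable (single? S c₁ a) λ ¬s → none (a , sa , a≢z , ¬s)
    ... | yes (a , sa@(pa , ha) , a≢z , ¬s) =
      align-singles C₁ m c₃ (≤-trans (count-⊂ sub a-split a-unsplit) (≤-pred fuel)) (P₃ , b₃) sz₃
      where
      c₃ : Colouring N
      c₃ v = if ⌊ c₁ v ≟ c₁ a ⌋ then c₂ a else c₂ v
      leaves : ∀ v → v ∈ₛ S → c₁ v ≢ c₁ a → c₂ a ≢ c₂ v
      leaves v p q e with ha v p (≡-sym e)
      ... | refl = q refl
      P₃ : ProperOn G S c₃
      P₃ u v p q uv with c₁ u ≟ c₁ a | c₁ v ≟ c₁ a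
      ... | yes e | yes f = λ _ → P₁ u v p q uv (trans e (≡-sym f))
      ... | yes e | no f  = leaves v q f
      ... | no e  | yes f = leaves u p e ∘ ≡-sym
      ... | no e  | no f  = P₂ u v p q uv
      b₃ : ∀ v → v ∈ₛ S → c₃ v < suc κ
      b₃ v p with c₁ v ≟ c₁ a
      ... | yes _ = b₂ a pa
      ... | no _  = b₂ v p
      -- Both `z` and `a` are singletons of `c₂`, hence adjacent, so `c₁` separates them and the
      -- recolouring leaves `z` alone.
      z-outside : c₁ z ≢ c₁ a
      z-outside e = P₁ z a pz pa (singles-adjacent C₂ sz sa (a≢z ∘ ≡-sym)) e
      sz₃ : Single S c₃ z
      sz₃ = pz , h
        where
        h : ∀ u → u ∈ₛ S → c₃ u ≡ c₃ z → u ≡ z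
        h u p e with c₁ u ≟ c₁ a | c₁ z ≟ c₁ a
        ... | _     | yes f = contradiction f z-outside
        ... | yes _ | no _  = contradiction (hz a pa e) a≢z
        ... | no _  | no _  = hz u p e
      sub : ⟦ split? c₁ c₃ ⟧ ⊆ ⟦ split? c₁ c₂ ⟧
      sub v q with ∈⟦⟧⁻ (split? c₁ c₃) q
      ... | p , u , pu , e , d = ∈⟦⟧⁺ (split? c₁ c₂) (p , u , pu , e , d′)
        where
        d′ : c₂ u ≢ c₂ v
        d′ with c₁ u ≟ c₁ a | c₁ v ≟ c₁ a
        ... | yes _ | yes _ = contradiction refl d
        ... | yes f | no g  = contradiction (trans (≡-sym e) f) g
        ... | no f  | yes g = contradiction (trans e g) f
        ... | no _  | no _  = d
      -- Not being a singleton of `c₁`, `a` shares its `c₁`-class with another vertex, which `c₂`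
      -- colours differently because `a` is a singleton there.
      a-split : a ∈ₛ ⟦ split? c₁ c₂ ⟧
      a-split = decidable-stable (a ∈? ⟦ split? c₁ c₂ ⟧) λ ¬split → ¬s (pa , λ u pu e →
        decidable-stable (u Fin.≟ a) λ u≢a → ¬split (∈⟦⟧⁺ (split? c₁ c₂) (pa , u , pu , e , u≢a ∘ ha u pu)))
      a-unsplit : ¬ a ∈ₛ ⟦ split? c₁ c₃ ⟧
      a-unsplit q with ∈⟦⟧⁻ (split? c₁ c₃) q
      ... | _ , u , pu , e , d with c₁ u ≟ c₁ a | c₁ a ≟ c₁ a
      ...   | yes _ | yes _ = d refl
      ...   | yes _ | no g  = g refl
      ...   | no f  | _     = f e

    -- Gallai's theorem.
    critical-nonjoin-count : (∀ z → z ∈ₛ S → ¬ ¬ Colourable G (S ∖ ⁅ z ⁆) κ) →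
      (∀ A B → NonEmpty A → NonEmpty B → A ⊆ S → B ⊆ S → S ⊆ A ∪ B → Disjoint A B → ¬ Complete A B) →
      2 * κ < count S
    critical-nonjoin-count critical nonjoin = ≰⇒> λ small → nonempty λ (w , pw) → single-at pw λ (c , C , _) →
      ¬¬-minimal (λ (c , _) → count (singles S c)) (c , C) λ ((c₁ , C₁) , min) →
      main small c₁ C₁ (λ c C → min (c , C)) pw
      where
      nonempty : ¬ ¬ NonEmpty S
      nonempty k = χ>κ ((λ _ → 0) , (λ u _ p → contradiction (u , p) k) , λ v p → contradiction (v , p) k)

      -- Criticality colours the rest with `κ` colours, and `z` receives the new colour `κ`.
      single-at : ∀ {z} → z ∈ₛ S → ¬ ¬ (∃[ c ] (ProperColouringWith G S (suc κ) c × Single S c z))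
      single-at {z} pz k = critical z pz λ (c , P , b) → k (new c , (P′ c P b , b′ c b) , pz , h c b)
        where
        new : Colouring N → Colouring N
        new c v = if ⌊ v Fin.≟ z ⌋ then κ else c v
        module _ (c : Colouring N) (b : ∀ v → v ∈ₛ (S ∖ ⁅ z ⁆) → c v < κ) where
          b″ : ∀ v → v ∈ₛ S → v ≢ z → c v < κ
          b″ v p q = b v (∈∖⁅⁆⁺ S p q)
          b′ : ∀ v → v ∈ₛ S → new c v < suc κ
          b′ v p with v Fin.≟ z
          ... | yes _ = ≤-refl
          ... | no q = m≤n⇒m≤1+n (b″ v p q)
          h : ∀ u → u ∈ₛ S → new c u ≡ new c z → u ≡ z
          h u p e with u Fin.≟ z | z Fin.≟ z
          ... | yes q | _ = q
          ... | no q | yes _ = contradiction e (<⇒≢ (b″ u p q))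
          ... | no q | no r = contradiction refl r
        P′ : ∀ c → ProperOn G (S ∖ ⁅ z ⁆) c → (∀ v → v ∈ₛ (S ∖ ⁅ z ⁆) → c v < κ) → ProperOn G S (new c)
        P′ c P b u v p q a with u Fin.≟ z | v Fin.≟ z
        ... | yes refl | yes refl = λ _ → adj⇒≢ a refl
        ... | yes _ | no r = <⇒≢ (b″ c b v q r) ∘ ≡-sym
        ... | no r | yes _ = <⇒≢ (b″ c b u p r)
        ... | no r | no r′ = P u v (∈∖⁅⁆⁺ S p r) (∈∖⁅⁆⁺ S q r′) a

      main : count S ≤ 2 * κ → ∀ c₁ → ProperColouringWith G S (suc κ) c₁ →
        (∀ c → ProperColouringWith G S (suc κ) c → count (singles S c₁) ≤ count (singles S c)) →
        ∀ {w} → w ∈ₛ S → ⊥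
      main small c₁ C₁ min {w} pw with any? (single? S c₁)
      -- Without singletons the uniqueness hypothesis is vacuous, so any vertex `w` can be the
      -- exceptional one.
      ... | no none = <⇒≱ (count-unique-single C₁ pw λ y s → contradiction (y , s) none) small
      ... | yes (x , sx) with any? (λ y → single? S c₁ y ×-dec ¬? (y Fin.≟ x))
      ...   | no none = <⇒≱ (count-unique-single C₁ (proj₁ sx) λ y s →
                decidable-stable (y Fin.≟ x) λ y≢x → none (y , s , y≢x)) small
      ...   | yes (y , sy , y≢x) = ¬¬-decide Partner λ partner? →
                nonjoin ⟦ partner? ⟧ (S ∖ ⟦ partner? ⟧)
                  (y , ∈⟦⟧⁺ partner? (y≢x , c₁ , C₁ , min , sx , sy))
                  (x , ∈∖⁺ S ⟦ partner? ⟧ (proj₁ sx) λ p → proj₁ (∈⟦⟧⁻ partner? p) refl)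
                  (λ v p → partner⇒∈ (∈⟦⟧⁻ partner? p))
                  (∖-⊆ S ⟦ partner? ⟧)
                  (⊆-∖-∪ S ⟦ partner? ⟧)
                  (λ v p q → proj₂ (∈∖⁻ S ⟦ partner? ⟧ q) p)
                  λ u z p q → decidable-stable (adj G u z Bool.≟ true) λ uz →
                    partner-step (∈⟦⟧⁻ partner? p) (proj₁ (∈∖⁻ S ⟦ partner? ⟧ q)) uz
                      λ r → proj₂ (∈∖⁻ S ⟦ partner? ⟧ q) (∈⟦⟧⁺ partner? r)
        where
        -- The candidates for one side of the join. The clause `v ≢ x` keeps `x` in the complement,
        -- so that the other side is non-empty too.
        Partner : Pred (Fin N) 0ℓ
        Partner v = v ≢ x × ∃[ c ] (ProperColouringWith G S (suc κ) c ×
          (∀ c′ → ProperColouringWith G S (suc κ) c′ → count (singles S c) ≤ count (singles S c′)) ×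
          Single S c x × Single S c v)

        partner⇒∈ : ∀ {v} → Partner v → v ∈ₛ S
        partner⇒∈ (_ , _ , _ , _ , _ , p , _) = p

        partner-step : ∀ {u z} → Partner u → z ∈ₛ S → adj G u z ≢ true → ¬ ¬ Partner z
        partner-step {u} {z} (u≢x , c , C , minc , sx , su) pz uz k with z Fin.≟ u
        ... | yes refl = k (u≢x , c , C , minc , sx , su)
        ... | no z≢u = single-at pz λ (c₂ , C₂ , sz₂) → finish (align-singles C _ c₂ ≤-refl C₂ sz₂)
          where
          -- As singletons of `c`, `x` and `u` are adjacent, whereas `z` is not adjacent to `u`.
          z≢x : z ≢ x
          z≢x refl = uz (singles-adjacent C su sx u≢x)
          finish : ¬ (∃[ c₃ ] (ProperColouringWith G S (suc κ) c₃ × Single S c₃ z ×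
                     (∀ a → Single S c₃ a → a ≢ z → Single S c a)))
          finish (c₃ , C₃ , sz , aligned) = k (z≢x , c₃ , C₃ , (λ c′ C′ → ≤-trans few (minc c′ C′)) , sx₃ , sz)
            where
            A = singles S c ∖ ⁅ u ⁆
            B = singles S c₃ ∖ ⁅ z ⁆
            -- The singleton `z` of `c₃` is not adjacent to `u`, so `u` is not a singleton of `c₃`.
            B⊆A : B ⊆ A
            B⊆A a p with ∈∖⁻ (singles S c₃) ⁅ z ⁆ p
            ... | q , r = ∈∖⁅⁆⁺ (singles S c) (∈⟦⟧⁺ (single? S c) (aligned a sa (r ∘ ∈⁅⁆⁺))) a≢u
              where
              sa = ∈⟦⟧⁻ (single? S c₃) q
              a≢u : a ≢ u
              a≢u refl = uz (singles-adjacent C₃ sa sz (z≢u ∘ ≡-sym))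
            su∈ : u ∈ₛ singles S c
            su∈ = ∈⟦⟧⁺ (single? S c) su
            few : count (singles S c₃) ≤ count (singles S c)
            few = ≤-trans (count-∖ (singles S c₃) z) (≤-trans (s≤s (count-mono B⊆A)) (count-∖-∈ (singles S c) su∈))
            -- If `x` were lost, `B` would be a proper subset of `A`, and `c₃` would have fewer
            -- singletons than `c`.
            sx₃ : Single S c₃ x
            sx₃ = decidable-stable (single? S c₃ x) λ ¬sx → <⇒≱
              (≤-trans (s≤s (count-∖ (singles S c₃) z)) (≤-trans (s≤s (count-⊂ {v = x} B⊆A
                (∈∖⁅⁆⁺ (singles S c) (∈⟦⟧⁺ (single? S c) sx) (u≢x ∘ ≡-sym))
                λ p → ¬sx (∈⟦⟧⁻ (single? S c₃) (∖-⊆ (singles S c₃) ⁅ z ⁆ x p))))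
                (count-∖-∈ (singles S c) su∈)))
              (minc c₃ C₃)

  -- Counterexamples to vertex bounds, and joins

  -- With `k = suc κ`, a counterexample to the claim that chromatic number at least `k` and local
  -- `(k - j)`-colourability force at least `qk/p` vertices. The slack `j` is fixed while `l` may
  -- vary with `v`; in this form the condition passes to the sides of a join.
  record Dense (j p q : ℕ) (S : VSet N) (κ : ℕ) : Set where
    field
      χ>κ   : ¬ Colourable G S κ
      local : ∀ v → v ∈ₛ S → ∃[ l ] (Colourable G (S ∩ closedNbhd G v) l × l + j ≤ suc κ)
      few   : p * count S < q * suc κ

  open Dense

  -- Each hypothesis passes to a vertex-deleted subgraph that is still not κ-colourable and,
  -- as χ and the local bounds add up over joins, to one of the two sides of a join.
  dense-nonjoin : ∀ {j p q} m S κ → count S < m → Dense j p q S κ →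
    ¬ ¬ (∃[ T ] ∃[ k ] (Dense j p q T k × 2 * k < count T))
  dense-nonjoin {j} {p} {q} (suc m) S κ fuel D K =
    K (S , κ , D , critical-nonjoin-count (χ>κ D) critical nonjoin)
    where
    critical : ∀ z → z ∈ₛ S → ¬ ¬ Colourable G (S ∖ ⁅ z ⁆) κ
    critical z pz ¬C = dense-nonjoin m (S ∖ ⁅ z ⁆) κ (≤-trans (count-∖-∈ S pz) (≤-pred fuel)) D′ K
      where
      D′ : Dense j p q (S ∖ ⁅ z ⁆) κ
      D′ .χ>κ = ¬C
      D′ .local v p with local D v (∖-⊆ S ⁅ z ⁆ v p)
      ... | l , C , h = l , colourable-mono sub ≤-refl C , h
        where
        sub : ((S ∖ ⁅ z ⁆) ∩ closedNbhd G v) ⊆ (S ∩ closedNbhd G v)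
        sub u r with ∈∩⁻ (S ∖ ⁅ z ⁆) (closedNbhd G v) r
        ... | r₁ , r₂ = ∈∩⁺ S (closedNbhd G v) (∖-⊆ S ⁅ z ⁆ u r₁) r₂
      D′ .few = ≤-<-trans (*-monoʳ-≤ p (count-mono (∖-⊆ S ⁅ z ⁆))) (few D)

    side : ∀ A B a b → NonEmpty A → NonEmpty B → A ⊆ S → B ⊆ S → Complete A B →
      IsChromaticNumber G A a → IsChromaticNumber G B b → suc κ ≤ a + b → p * count A < q * a → ⊥
    side A B zero b (v , pv) _ _ _ _ ((_ , _ , h) , _) _ _ _ = contradiction (h v pv) λ ()
    side A B (suc k) b _ (w , pw) A⊆S B⊆S AB (_ , minA) (_ , minB) κ≤ fewA =
      dense-nonjoin m A k (≤-trans (count-⊂ A⊆S (B⊆S w pw) λ r → adj⇒≢ (AB w w r pw) refl) (≤-pred fuel)) D′ K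
      where
      D′ : Dense j p q A k
      D′ .χ>κ C = 1+n≰n (minA k C)
      D′ .local v pv with local D v (A⊆S v pv)
      -- All of `B` lies in `N[v]` and takes at least `b` of the `l` colours. Since `suc κ ≤ a + b`,
      -- the `l₁` colours left for `A` satisfy `l₁ + j ≤ suc k`.
      ... | l , (c , P , h) , l≤ = bound (split-colours l (λ u r → h u (X⊆ u r)) (λ u r → h u (B⊆ u r))
              (proper-mono X⊆ P) (proper-mono B⊆ P)
              λ x b r s → P x b (X⊆ x r) (B⊆ b s) (AB x b (proj₁ (∈∩⁻ A (closedNbhd G v) r)) s))
        where
        X⊆ : (A ∩ closedNbhd G v) ⊆ (S ∩ closedNbhd G v)
        X⊆ u r with ∈∩⁻ A (closedNbhd G v) r
        ... | r₁ , r₂ = ∈∩⁺ S (closedNbhd G v) (A⊆S u r₁) r₂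
        B⊆ : B ⊆ (S ∩ closedNbhd G v)
        B⊆ u r = ∈∩⁺ S (closedNbhd G v) (B⊆S u r) (∈closedNbhd-adj (AB v u pv r))
        bound : ∃[ l₁ ] ∃[ l₂ ] (l₁ + l₂ ≡ l × Colourable G (A ∩ closedNbhd G v) l₁ × Colourable G B l₂) →
          ∃[ l₁ ] (Colourable G (A ∩ closedNbhd G v) l₁ × l₁ + j ≤ suc k)
        bound (l₁ , l₂ , refl , C₁ , C₂) = l₁ , C₁ , +-cancelʳ-≤ b (l₁ + j) (suc k) (begin
          l₁ + j + b   ≤⟨ +-monoʳ-≤ (l₁ + j) (minB l₂ C₂) ⟩
          l₁ + j + l₂  ≡⟨ swap l₁ j l₂ ⟩
          l₁ + l₂ + j  ≤⟨ l≤ ⟩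
          suc κ        ≤⟨ κ≤ ⟩
          suc k + b    ∎)
          where
          open ≤-Reasoning
          swap : ∀ a b c → a + b + c ≡ a + c + b
          swap = solve-∀
      D′ .few = fewA

    -- A side violating the vertex bound would be a smaller dense set, handled by induction. If
    -- neither does, the two bounds add up to a contradiction with `few`.
    nonjoin : ∀ A B → NonEmpty A → NonEmpty B → A ⊆ S → B ⊆ S → S ⊆ A ∪ B → Disjoint A B → ¬ Complete A B
    nonjoin A B nA nB A⊆S B⊆S cover disjoint AB = ¬¬-chromatic A λ (a , χA) → ¬¬-chromatic B λ (b , χB) →
      let κ≤ : suc κ ≤ a + b
          κ≤ = ≰⇒> λ h → χ>κ D (colourable-mono (λ _ r → r) h (colourable-∪ cover (proj₁ χA) (proj₁ χB)))
          bigA : q * a ≤ p * count A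
          bigA = ≮⇒≥ (side A B a b nA nB A⊆S B⊆S AB χA χB κ≤)
          bigB : q * b ≤ p * count B
          bigB = ≮⇒≥ (side B A b a nB nA B⊆S A⊆S (λ u v r s → adj-sym (AB v u s r)) χB χA
                   (≤-trans κ≤ (≤-reflexive (+-comm a b))))
      in <⇒≱ (few D) (begin
        q * suc κ                  ≤⟨ *-monoʳ-≤ q κ≤ ⟩
        q * (a + b)                ≡⟨ *-distribˡ-+ q a b ⟩
        q * a + q * b              ≤⟨ +-mono-≤ bigA bigB ⟩
        p * count A + p * count B  ≡⟨ *-distribˡ-+ p (count A) (count B) ⟨
        p * (count A + count B)    ≤⟨ *-monoʳ-≤ p (count-disjoint A⊆S B⊆S disjoint) ⟩
        p * count S                ∎)
      where open ≤-Reasoning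

  -- Vertex bounds for slack one and two

  ¬colourable⇒nonempty : ∀ {S κ} → ¬ Colourable G S κ → NonEmpty S
  ¬colourable⇒nonempty {S} ¬C with ∈-or-empty S
  ... | inj₁ p = p
  ... | inj₂ e = ⊥-elim (¬C ((λ _ → 0) , (λ u _ p → contradiction p (e u)) , λ v p → contradiction p (e v)))

  local-colour>0 : ∀ S v {l} → v ∈ₛ S → Colourable G (S ∩ closedNbhd G v) l → 0 < l
  local-colour>0 S v p (c , _ , h) = ≤-trans (s≤s z≤n) (h v (∈∩⁺ S (closedNbhd G v) p (∈closedNbhd-self v)))

  -- (3, 5) is attained by joins of 5-cycles.
  ¬dense₁ : ∀ {S κ} → ¬ Dense 1 3 5 S κ
  -- Gallai's bound `2k + 1` reaches `5(k + 1)/3` once `k ≥ 2`.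
  ¬dense₁ {S} {κ} D = dense-nonjoin _ S κ ≤-refl D λ (T , k , E , big) →
    final T k E (≮⇒≥ λ 2≤k → <⇒≱ (few E) (≤-trans (bound k 2≤k) (*-monoʳ-≤ 3 big)))
    where
    bound : ∀ k → 2 ≤ k → 5 * suc k ≤ 3 * suc (2 * k)
    bound (suc (suc t)) (s≤s (s≤s z≤n)) = m+n≤o⇒m≤o _ (≤-reflexive (identity t))
      where
      identity : ∀ t → 5 * (3 + t) + t ≡ 3 * (1 + 2 * (2 + t))
      identity = solve-∀
    -- Every local bound is now at most `k ≤ 1`, so `T` has no edges and is 1-colourable, while
    -- colouring `w` alone already forces `k ≥ 1`.
    final : ∀ T k → Dense 1 3 5 T k → k ≤ 1 → ⊥
    final T k E k≤1 with ¬colourable⇒nonempty (χ>κ E)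
    ... | w , pw with local E w pw
    ...   | l , C , h = χ>κ E (colourable-mono (λ _ r → r) (≤-trans (local-colour>0 T w pw C) l≤k) (independent⇒colourable edgeless))
      where
      l≤k : l ≤ k
      l≤k = ≤-pred (≤-trans (≤-reflexive (+-comm 1 l)) h)
      edgeless : Independent T
      edgeless u v pu pv a with local E u pu
      ... | l′ , (c , P , b) , h′ = P u v u∈ v∈ a (trans (zero-colour u u∈) (≡-sym (zero-colour v v∈)))
        where
        u∈ = ∈∩⁺ T (closedNbhd G u) pu (∈closedNbhd-self u)
        v∈ = ∈∩⁺ T (closedNbhd G u) pv (∈closedNbhd-adj a)
        zero-colour : ∀ x → x ∈ₛ (T ∩ closedNbhd G u) → c x ≡ 0
        zero-colour x r = n≤0⇒n≡0 (≤-pred (≤-trans (b x r) (≤-trans (≤-pred (≤-trans (≤-reflexive (+-comm 1 l′)) h′)) k≤1)))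

  triple : Fin N → Fin N → Fin N → VSet N
  triple u v w = ⟦ (λ x → x Fin.≟ u ⊎-dec x Fin.≟ v ⊎-dec x Fin.≟ w) ⟧

  module _ {u v w : Fin N} where

    ∈triple⁺ : ∀ {x} → x ≡ u ⊎ x ≡ v ⊎ x ≡ w → x ∈ₛ triple u v w
    ∈triple⁺ = ∈⟦⟧⁺ λ x → x Fin.≟ u ⊎-dec x Fin.≟ v ⊎-dec x Fin.≟ w

    ∈triple⁻ : ∀ {x} → x ∈ₛ triple u v w → x ≡ u ⊎ x ≡ v ⊎ x ≡ w
    ∈triple⁻ = ∈⟦⟧⁻ λ x → x Fin.≟ u ⊎-dec x Fin.≟ v ⊎-dec x Fin.≟ w

    count-triple : u ≢ v → u ≢ w → v ≢ w → 3 ≤ count (triple u v w)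
    count-triple u≢v u≢w v≢w = ≤-trans
      (s≤s (count≥2 (triple u v w ∖ ⁅ u ⁆)
        (∈∖⁅⁆⁺ (triple u v w) (∈triple⁺ (inj₂ (inj₁ refl))) (u≢v ∘ ≡-sym))
        (∈∖⁅⁆⁺ (triple u v w) (∈triple⁺ (inj₂ (inj₂ refl))) (u≢w ∘ ≡-sym)) v≢w))
      (count-∖-∈ (triple u v w) (∈triple⁺ (inj₁ refl)))

    triple-independent : adj G u v ≢ true → adj G u w ≢ true → adj G v w ≢ true → Independent (triple u v w)
    triple-independent uv uw vw x y p q a with ∈triple⁻ {x} p | ∈triple⁻ {y} q
    ... | inj₁ refl        | inj₁ refl        = adj⇒≢ a refl
    ... | inj₁ refl        | inj₂ (inj₁ refl) = uv a
    ... | inj₁ refl        | inj₂ (inj₂ refl) = uw a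
    ... | inj₂ (inj₁ refl) | inj₁ refl        = uv (adj-sym a)
    ... | inj₂ (inj₁ refl) | inj₂ (inj₁ refl) = adj⇒≢ a refl
    ... | inj₂ (inj₁ refl) | inj₂ (inj₂ refl) = vw a
    ... | inj₂ (inj₂ refl) | inj₁ refl        = uw (adj-sym a)
    ... | inj₂ (inj₂ refl) | inj₂ (inj₁ refl) = vw (adj-sym a)
    ... | inj₂ (inj₂ refl) | inj₂ (inj₂ refl) = adj⇒≢ a refl

  -- A nonjoin counterexample has κ ≤ 4 and 2κ + 1 vertices. It contains an independent triple, inside a neighbourhood or
  -- made of a vertex and two non-neighbours; deleting it leaves too few vertices for chromatic number κ.
  ¬dense₂ : ∀ {S κ} → ¬ Dense 2 6 11 S κ
  ¬dense₂ {S} {κ} D = dense-nonjoin _ S κ ≤-refl D λ (T , k , E , big) →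
    let k≤4 : k ≤ 4
        k≤4 = ≮⇒≥ λ 5≤k → <⇒≱ (few E) (≤-trans (bound k 5≤k) (*-monoʳ-≤ 6 big))
        small : count T ≤ suc (2 * k)
        small = ≮⇒≥ λ big′ → <⇒≱ (few E) (≤-trans (bound′ k) (*-monoʳ-≤ 6 big′))
    in final T k E big small k≤4
    where
    bound : ∀ k → 5 ≤ k → 11 * suc k ≤ 6 * suc (2 * k)
    bound (suc (suc (suc (suc (suc t))))) (s≤s (s≤s (s≤s (s≤s (s≤s z≤n))))) = m+n≤o⇒m≤o _ (≤-reflexive (identity t))
      where
      identity : ∀ t → 11 * (6 + t) + t ≡ 6 * (1 + 2 * (5 + t))
      identity = solve-∀
    bound′ : ∀ k → 11 * suc k ≤ 6 * suc (suc (2 * k))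
    bound′ k = m+n≤o⇒m≤o _ (≤-reflexive (identity k))
      where
      identity : ∀ k → 11 * suc k + suc k ≡ 6 * suc (suc (2 * k))
      identity = solve-∀

    final : ∀ T k → Dense 2 6 11 T k → 2 * k < count T → count T ≤ suc (2 * k) → k ≤ 4 → ⊥
    final T k E big small k≤4 with ¬colourable⇒nonempty (χ>κ E)
    ... | w , pw with local E w pw
    ...   | zero , C , _ = contradiction (local-colour>0 T w pw C) λ ()
    ...   | suc l , C@(c , P , b) , l≤ = clique-bound nonempty
      where
      W = T ∩ closedNbhd G w
      A = W ∖ ⁅ w ⁆
      B = T ∖ closedNbhd G w

      l+2≤k : suc (suc l) ≤ k
      l+2≤k = ≤-pred (≤-trans (≤-reflexive (cong suc (+-comm 2 l))) l≤)

      -- Deleting `I` lowers the chromatic number by at most one, so slack 2 becomes slack 1. In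
      -- terms of the decremented `k ≤ 3`, at most `2k` vertices remain, fewer than `5(k + 1)/3`,
      -- against `¬dense₁`.
      no-triple : ∀ I → I ⊆ T → Independent I → count I < 3
      no-triple I I⊆T ind = ≰⇒> λ 3≤I → remove k E small k≤4 (≤-trans (m≤n+m 2 (suc l)) l≤) 3≤I
        where
        remove : ∀ k → Dense 2 6 11 T k → count T ≤ suc (2 * k) → k ≤ 4 → 2 ≤ suc k → 3 ≤ count I → ⊥
        remove zero _ _ _ 2≤1 _ = <⇒≱ 2≤1 ≤-refl
        remove (suc k) E small k≤4 _ 3≤I = ¬dense₁ {T ∖ I} {k} E′
          where
          rest : count (T ∖ I) ≤ 2 * k
          rest = +-cancelʳ-≤ 3 _ _ (begin
            count (T ∖ I) + 3        ≤⟨ +-monoʳ-≤ (count (T ∖ I)) 3≤I ⟩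
            count (T ∖ I) + count I  ≤⟨ count-disjoint (∖-⊆ T I) I⊆T (λ v p → proj₂ (∈∖⁻ T I p)) ⟩
            count T                  ≤⟨ small ⟩
            suc (2 * suc k)          ≡⟨ identity k ⟩
            2 * k + 3                ∎)
            where
            open ≤-Reasoning
            identity : ∀ k → suc (2 * suc k) ≡ 2 * k + 3
            identity = solve-∀
          E′ : Dense 1 3 5 (T ∖ I) k
          E′ .χ>κ C = χ>κ E (colourable-∪ (⊆-∖-∪ T I) (independent⇒colourable ind) C)
          E′ .local v p with local E v (∖-⊆ T I v p)
          ... | l , C , h = l , colourable-mono sub ≤-refl C , ≤-pred (≤-trans (≤-reflexive (≡-sym (+-suc l 1))) h)
            where
            sub : ((T ∖ I) ∩ closedNbhd G v) ⊆ (T ∩ closedNbhd G v)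
            sub u r with ∈∩⁻ (T ∖ I) (closedNbhd G v) r
            ... | r₁ , r₂ = ∈∩⁺ T (closedNbhd G v) (∖-⊆ T I u r₁) r₂
          E′ .few = begin-strict
            3 * count (T ∖ I)  ≤⟨ *-monoʳ-≤ 3 rest ⟩
            3 * (2 * k)        ≡⟨ identity k ⟩
            5 * k + k          <⟨ +-monoʳ-< (5 * k) (s≤s (≤-pred k≤4)) ⟩
            5 * k + 4          ≤⟨ +-monoʳ-≤ (5 * k) (n≤1+n 4) ⟩
            5 * k + 5          ≡⟨ +-comm (5 * k) 5 ⟩
            5 + 5 * k          ≡⟨ *-suc 5 k ⟨
            5 * suc k          ∎
            where
            open ≤-Reasoning
            identity : ∀ k → 3 * (2 * k) ≡ 5 * k + k
            identity = solve-∀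

      w∈W : w ∈ₛ W
      w∈W = ∈∩⁺ T (closedNbhd G w) pw (∈closedNbhd-self w)

      C-A : Colourable G A l
      C-A = drop-colour (proper-mono (∖-⊆ W ⁅ w ⁆) P , λ v p → b v (∖-⊆ W ⁅ w ⁆ v p)) (b w w∈W) unused
        where
        unused : ∀ v → v ∈ₛ A → c v ≢ c w
        unused v p e with ∈∖⁻ W ⁅ w ⁆ p
        ... | q , r = P w v w∈W q (∈closedNbhd⁻ (proj₂ (∈∩⁻ T (closedNbhd G w) q)) λ { refl → r (∈⁅⁆⁺ {v = w} refl) }) (≡-sym e)

      -- Colour classes inside `A` are independent, hence have at most two vertices.
      count-A : count A ≤ l * 2
      count-A with C-A
      ... | c′ , P′ , b′ = count-fibres-≤ A c′ l 2 b′ λ i _ → ≤-pred (no-triple (fibre A c′ i) (sub i) (fibre-independent i P′))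
        where
        sub : ∀ i → fibre A c′ i ⊆ T
        sub i v p = proj₁ (∈∩⁻ T (closedNbhd G w) (∖-⊆ W ⁅ w ⁆ v (proj₁ (∈fibre⁻ A c′ p))))

      -- Here `|T| ≥ 2k + 1 ≥ 2l + 5`, while `W` has at most `2l + 1` vertices.
      count-B : 4 ≤ count B
      count-B = +-cancelˡ-≤ (suc (l * 2)) _ _ (begin
        suc (l * 2) + 4              ≡⟨ identity l ⟩
        suc (2 * suc (suc l))        ≤⟨ s≤s (*-monoʳ-≤ 2 l+2≤k) ⟩
        suc (2 * k)                  ≤⟨ big ⟩
        count T                      ≤⟨ count-cover cover ⟩
        count W + count B            ≤⟨ +-monoˡ-≤ (count B) (≤-trans (count-∖ W w) (s≤s count-A)) ⟩
        suc (l * 2) + count B        ∎)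
        where
        open ≤-Reasoning
        identity : ∀ l → suc (l * 2) + 4 ≡ suc (2 * suc (suc l))
        identity = solve-∀
        cover : T ⊆ W ∪ B
        cover v p = [ (λ q → inj₁ (∈∩⁺ T (closedNbhd G w) p q)) , (λ q → inj₂ (∈∖⁺ T (closedNbhd G w) p q)) ]′
          (toSum (v ∈? closedNbhd G w))

      B-clique : ∀ u v → u ∈ₛ B → v ∈ₛ B → u ≢ v → adj G u v ≡ true
      B-clique u v p q u≢v = decidable-stable (adj G u v Bool.≟ true) λ ¬uv →
        <⇒≱ (no-triple (triple w u v) sub (triple-independent (far p) (far q) ¬uv))
          (count-triple (w≢ p) (w≢ q) u≢v)
        where
        far : ∀ {x} → x ∈ₛ B → adj G w x ≢ true
        far r a = proj₂ (∈∖⁻ T (closedNbhd G w) r) (∈closedNbhd-adj a)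
        w≢ : ∀ {x} → x ∈ₛ B → w ≢ x
        w≢ r refl = proj₂ (∈∖⁻ T (closedNbhd G w) r) (∈closedNbhd-self w)
        sub : triple w u v ⊆ T
        sub x r with ∈triple⁻ {x = x} r
        ... | inj₁ refl        = pw
        ... | inj₂ (inj₁ refl) = ∖-⊆ T (closedNbhd G w) u p
        ... | inj₂ (inj₂ refl) = ∖-⊆ T (closedNbhd G w) v q

      nonempty : NonEmpty B
      nonempty with ∈-or-empty B
      ... | inj₁ p = p
      ... | inj₂ e = contradiction (≤-trans count-B (≤-reflexive (count-empty e))) λ ()

      -- The clique `B` lies in `N[u]`, where `l′ ≤ k - 1 ≤ 3` colours suffice, too few for four
      -- vertices.
      clique-bound : NonEmpty B → ⊥
      clique-bound (u , pu) with local E u (∖-⊆ T (closedNbhd G w) u pu)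
      ... | l′ , (c′ , P′ , b′) , l′≤ = <⇒≱ count-B (begin
          count B  ≤⟨ count-fibres-≤ B c′ l′ 1 (λ v p → b′ v (B⊆ v p)) (λ i _ → count-subsingleton (rainbow i)) ⟩
          l′ * 1   ≡⟨ *-identityʳ l′ ⟩
          l′       ≤⟨ ≤-pred (≤-pred (≤-trans (≤-reflexive (+-comm 2 l′)) (≤-trans l′≤ (s≤s k≤4)))) ⟩
          3        ∎)
        where
        open ≤-Reasoning
        B⊆ : B ⊆ (T ∩ closedNbhd G u)
        B⊆ v p = ∈∩⁺ T (closedNbhd G u) (∖-⊆ T (closedNbhd G w) v p)
          ([ (λ { refl → ∈closedNbhd-self u }) , (∈closedNbhd-adj ∘ B-clique u v pu p) ]′ (toSum (u Fin.≟ v)))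
        rainbow : ∀ i x y → x ∈ₛ fibre B c′ i → y ∈ₛ fibre B c′ i → x ≡ y
        rainbow i x y p q with ∈fibre⁻ B c′ p | ∈fibre⁻ B c′ q
        ... | px , cx | py , cy = decidable-stable (x Fin.≟ y) λ x≢y →
              P′ x y (B⊆ x px) (B⊆ y py) (B-clique x y px py x≢y) (trans cx (≡-sym cy))

-- Colours of a colouring

colours : Colouring n → VSet n → List ℕ
colours {n} σ S = deduplicate _≟_ (map σ (filterᵇ S (allFin n)))

∈colours⁺ : (σ : Colouring n) (S : VSet n) {v : Fin n} → v ∈ₛ S → σ v ∈ colours σ S
∈colours⁺ σ S {v} p = ∈-deduplicate⁺ _≟_ (∈-map⁺ σ (∈-filter⁺ (T? ∘ S) (∈-allFin v) (subst T (≡-sym p) _)))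

∈colours⁻ : (σ : Colouring n) (S : VSet n) {x : ℕ} → x ∈ colours σ S → ∃[ v ] (v ∈ₛ S × σ v ≡ x)
∈colours⁻ {n} σ S x∈ with ∈-map⁻ σ (∈-deduplicate⁻ _≟_ (map σ (filterᵇ S (allFin n))) x∈)
... | v , v∈ , refl = v , Equivalence.to T-≡ (proj₂ (∈-filter⁻ (T? ∘ S) {xs = allFin n} v∈)) , refl

lookup-injective : {xs : List ℕ} → Unique xs → ∀ {i j} → lookup xs i ≡ lookup xs j → i ≡ j
lookup-injective (_ ∷ _) {zero} {zero} e = refl
lookup-injective (x ∷ _) {zero} {suc j} e = contradiction e (All.lookup x (∈-lookup j))
lookup-injective (x ∷ _) {suc i} {zero} e = contradiction (≡-sym e) (All.lookup x (∈-lookup i))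
lookup-injective (_ ∷ u) {suc i} {suc j} e = cong suc (lookup-injective u e)

-- Locating each entry of `xs` among the colours of `S` is an injection, since `xs` has no
-- repetitions.
numColours-≥ : (σ : Colouring n) (S : VSet n) {xs : List ℕ} → Unique xs →
  (∀ i → ∃[ u ] (u ∈ₛ S × σ u ≡ lookup xs i)) → length xs ≤ numColours σ S
numColours-≥ σ S {xs} xs! f = injective⇒≤ {f = g} λ {i} {j} e → lookup-injective xs! (begin
    lookup xs i                ≡⟨ lookup-g i ⟩
    lookup (colours σ S) (g i) ≡⟨ cong (lookup (colours σ S)) e ⟩
    lookup (colours σ S) (g j) ≡⟨ lookup-g j ⟨
    lookup xs j                ∎)
  where
  open ≡-Reasoning
  seen : ∀ i → σ (proj₁ (f i)) ∈ colours σ S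
  seen i = ∈colours⁺ σ S (proj₁ (proj₂ (f i)))
  g : Fin (length xs) → Fin (numColours σ S)
  g i = index (seen i)
  lookup-g : ∀ i → lookup xs i ≡ lookup (colours σ S) (g i)
  lookup-g i = trans (≡-sym (proj₂ (proj₂ (f i)))) (lookup-index (seen i))

-- Transversals of the colour classes

module _ {N : ℕ} (G : Graph N) {σ : Colouring N} (Pσ : ProperOn G full σ) where

  open Colourings G

  private
    L : List ℕ
    L = colours σ full

    m : ℕ
    m = numColours σ full

    L! : Unique L
    L! = deduplicate-! _≟_ _

    colourIndex : Fin N → Fin m
    colourIndex v = index (∈colours⁺ σ full {v} refl)

    σ≡lookup : ∀ v → σ v ≡ lookup L (colourIndex v)
    σ≡lookup v = lookup-index (∈colours⁺ σ full {v} refl)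

    -- The values of `σ` are arbitrary numbers; `c` renumbers them from 0 to `m - 1`, as
    -- `ProperColouringWith` demands.
    c : Colouring N
    c = toℕ ∘ colourIndex

    c≡⇒σ≡ : ∀ {v} i → c v ≡ toℕ i → σ v ≡ lookup L i
    c≡⇒σ≡ {v} i e = trans (σ≡lookup v) (cong (lookup L) (toℕ-injective e))

    representative : Fin m → Fin N
    representative i = proj₁ (∈colours⁻ σ full (∈-lookup {xs = L} i))

    σ-representative : ∀ i → σ (representative i) ≡ lookup L i
    σ-representative i = proj₂ (proj₂ (∈colours⁻ σ full (∈-lookup {xs = L} i)))

  numColours-colouring : ProperColouringWith G full m c
  numColours-colouring = (λ u v p q a e → Pσ u v p q a (trans (c≡⇒σ≡ (colourIndex v) e) (≡-sym (σ≡lookup v)))) ,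
    λ v _ → toℕ<n (colourIndex v)

  -- A vertex is kept if it is the chosen representative of its own colour, so each class
  -- contributes exactly one.
  transversal : VSet N
  transversal = ⟦ (λ v → representative (colourIndex v) Fin.≟ v) ⟧

  ∈transversal⁻ : ∀ {v} → v ∈ₛ transversal → representative (colourIndex v) ≡ v
  ∈transversal⁻ = ∈⟦⟧⁻ λ v → representative (colourIndex v) Fin.≟ v

  representative∈ : ∀ i → representative i ∈ₛ transversal
  representative∈ i = ∈⟦⟧⁺ (λ v → representative (colourIndex v) Fin.≟ v) (cong representative
    (lookup-injective L! (trans (≡-sym (σ≡lookup (representative i))) (σ-representative i))))

  transversal-nonempty : Fin N → NonEmpty transversal
  transversal-nonempty v = representative (colourIndex v) , representative∈ (colourIndex v)

  count-transversal : count transversal ≤ numColours σ full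
  count-transversal = ≤-trans
    (count-fibres-≤ transversal c m 1 (λ v _ → toℕ<n (colourIndex v)) λ i _ → count-subsingleton (rainbow i))
    (≤-reflexive (*-identityʳ m))
    where
    rainbow : ∀ i u v → u ∈ₛ fibre transversal c i → v ∈ₛ fibre transversal c i → u ≡ v
    rainbow i u v p q with ∈fibre⁻ transversal c p | ∈fibre⁻ transversal c q
    ... | pu , cu | pv , cv = trans (≡-sym (∈transversal⁻ pu))
          (trans (cong representative (toℕ-injective (trans cu (≡-sym cv)))) (∈transversal⁻ pv))

  numColours-transversal : numColours σ full ≤ numColours σ transversal
  numColours-transversal = numColours-≥ σ transversal L! λ i → representative i , representative∈ i , σ-representative i

  -- If every closed neighbourhood misses a colour, the last colour class can be recoloured vertex by vertex.
  colourable-pred : ∀ {κ} → numColours σ full ≡ suc κ →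
    (∀ v → numColours σ (closedNbhd G v) < numColours σ full) → Colourable G full κ
  colourable-pred {κ} m≡ unsaturated = absorb-class
    (proj₁ numColours-colouring , λ v p → ≤-trans (proj₂ numColours-colouring v p) (≤-reflexive m≡))
    (λ v → toℕ (proj₁ (missing v)))
    λ v p cv → let i , i∉ = missing v in
      -- The missing colour is not the last one, which `v` itself has.
      ≤∧≢⇒< (≤-pred (≤-trans (toℕ<n i) (≤-reflexive m≡)))
        (λ e → i∉ (v , ∈closedNbhd-self v , c≡⇒σ≡ i (trans cv (≡-sym e)))) ,
      λ u q a e → i∉ (u , ∈closedNbhd-adj a , c≡⇒σ≡ i e)
    where
    missing : ∀ v → ∃[ i ] ¬ (∃[ u ] (u ∈ₛ closedNbhd G v × σ u ≡ lookup L i))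
    missing v = ¬∀⟶∃¬ m _ (λ i → any? λ u → u ∈? closedNbhd G v ×-dec σ u ≟ lookup L i)
      λ all → <⇒≱ (unsaturated v) (numColours-≥ σ (closedNbhd G v) L! all)

-- The lower bound on the discrepancy

theorem1p5 : (s : ℕ) → 2 ≤ s → (n : ℕ) → (G : Graph (suc n)) →
    LocallyColourable G s →
    (χ : ℕ) → IsChromaticNumber G full χ → 6 * χ < 11 * s + 16 →
    (φ : ℕ) → IsChromaticDiscrepancy G φ →
    χ ≤ φ + s
theorem1p5 s _ n G loc χ (_ , χ-min) χ-small φ ((σ , Pσ , _ , φ-max) , _) = ≮⇒≥ contra
  where
  open Colourings G
  open Dense

  m = numColours σ full

  -- The maximality of `φ` speaks of exact chromatic numbers, which are at hand only under a double
  -- negation; the inequality is decidable, hence stable.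
  value-≤ : ∀ S k → NonEmpty S → Colourable G S k → numColours σ S ≤ φ + k
  value-≤ S k nS C = decidable-stable (numColours σ S ≤? φ + k) λ K → ¬¬-chromatic S λ (k′ , χ′) →
    K (≤-trans (m≤n+m∸n (numColours σ S) k′) (≤-trans (≤-reflexive (+-comm k′ _))
      (+-mono-≤ (φ-max S _ nS (k′ , χ′ , refl)) (proj₂ χ′ k C))))

  contra : φ + s < χ → ⊥
  contra φ+s<χ = ¬dense₂ R-dense
    where
    open ≤-Reasoning

    χ≢m : χ ≢ m
    χ≢m χ≡m = 1+n≰n (≤-trans (≤-reflexive (trans (≡-sym m≡suc) (≡-sym χ≡m))) (χ-min (pred m)
      (colourable-pred G Pσ m≡suc λ v → ≤-<-trans (value-≤ _ s (v , ∈closedNbhd-self v) (loc v))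
        (≤-trans φ+s<χ (≤-reflexive χ≡m)))))
      where
      m≡suc : m ≡ suc (pred m)
      m≡suc = ≡-sym (suc-pred m {{>-nonZero (≤-trans (s≤s z≤n) (≤-trans φ+s<χ (≤-reflexive χ≡m)))}})

    χ<m : χ < m
    χ<m = ≤∧≢⇒< (χ-min m (_ , numColours-colouring G Pσ)) χ≢m

    R = transversal G Pσ
    -- Chosen so that `suc K = m - φ`, the lower bound on the chromatic number of `R`; the
    -- subtraction is exact because `φ < m`.
    K = m ∸ suc φ

    m≡ : φ + suc K ≡ m
    m≡ = trans (+-suc φ K) (m+[n∸m]≡n (≤-trans (s≤s (m≤m+n φ s)) (<⇒≤ (≤-<-trans φ+s<χ χ<m))))

    R-nonempty : NonEmpty R
    R-nonempty = transversal-nonempty G Pσ zero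

    R-dense : Dense 2 6 11 R K
    -- All `m` colours appear on `R`, so a `K`-colouring would give `m ≤ φ + K`.
    R-dense .χ>κ C = <⇒≱ (≤-trans (≤-reflexive (≡-sym (+-suc φ K))) (≤-reflexive m≡)) (≤-trans (numColours-transversal G Pσ)
      (value-≤ R K R-nonempty C))
    -- The slack 2 has one unit from `φ + s < χ` and one from `χ < m`.
    R-dense .local v _ = s , colourable-mono (λ u p → proj₂ (∈∩⁻ R (closedNbhd G v) p)) ≤-refl (loc v) ,
      +-cancelˡ-≤ φ _ _ (begin
        φ + (s + 2)       ≡⟨ trans (≡-sym (+-assoc φ s 2)) (+-comm (φ + s) 2) ⟩
        suc (suc (φ + s)) ≤⟨ s≤s φ+s<χ ⟩
        suc χ            ≤⟨ χ<m ⟩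
        m                ≡⟨ m≡ ⟨
        φ + suc K        ∎)
    -- As `|R| ≤ m`, it suffices that `11φ < 5m`. This is the sum of 11 times `φ + s + 1 ≤ χ`, the
    -- hypothesis `6χ < 11s + 16`, and 5 times `χ + 1 ≤ m`.
    R-dense .few = +-cancelʳ-< (5 * φ + 11 * s + 11) _ _ (begin-strict
      6 * count R + (5 * φ + 11 * s + 11)      ≤⟨ +-monoˡ-≤ _ (*-monoʳ-≤ 6 (≤-trans (count-transversal G Pσ) (≤-reflexive (≡-sym m≡)))) ⟩
      6 * (φ + suc K) + (5 * φ + 11 * s + 11)  ≡⟨ rearrange₁ φ s (suc K) ⟩
      11 * suc (φ + s) + 6 * suc K             ≤⟨ +-monoˡ-≤ _ (*-monoʳ-≤ 11 φ+s<χ) ⟩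
      11 * χ + 6 * suc K                       ≡⟨ rearrange₂ χ (suc K) ⟩
      6 * χ + (5 * χ + 6 * suc K)              <⟨ +-monoˡ-< _ χ-small ⟩
      11 * s + 16 + (5 * χ + 6 * suc K)        ≡⟨ rearrange₃ χ s (suc K) ⟩
      5 * suc χ + (11 * s + 11 + 6 * suc K)    ≤⟨ +-monoˡ-≤ _ (*-monoʳ-≤ 5 (≤-trans χ<m (≤-reflexive (≡-sym m≡)))) ⟩
      5 * (φ + suc K) + (11 * s + 11 + 6 * suc K)  ≡⟨ rearrange₄ φ s (suc K) ⟩
      11 * suc K + (5 * φ + 11 * s + 11)       ∎)
      where
      rearrange₁ : ∀ φ s k → 6 * (φ + k) + (5 * φ + 11 * s + 11) ≡ 11 * suc (φ + s) + 6 * k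
      rearrange₁ = solve-∀
      rearrange₂ : ∀ χ k → 11 * χ + 6 * k ≡ 6 * χ + (5 * χ + 6 * k)
      rearrange₂ = solve-∀
      rearrange₃ : ∀ χ s k → 11 * s + 16 + (5 * χ + 6 * k) ≡ 5 * suc χ + (11 * s + 11 + 6 * k)
      rearrange₃ = solve-∀
      rearrange₄ : ∀ φ s k → 5 * (φ + k) + (11 * s + 11 + 6 * k) ≡ 11 * k + (5 * φ + 11 * s + 11)
      rearrange₄ = solve-∀
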